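{- Let $n\ge1$ and $P=\Phi^+(B_n)=\{(i,j)\colon 1\le i\le j\le 2n-1,\ i+j\ge 2n\}$. Then for $k=2,4,\dots,2n-2$ we have \[2\sum_{\substack{(i,j)\in P\\ j-i=k}}\mathbb{1}_{(i,j)}-\sum_{\substack{(i,j)\in P\\ j-i=k-1}}\mathbb{1}_{(i,j)}-\sum_{\substack{(i,j)\in P\\ j-i=k+1}}\mathbb{1}_{(i,j)}\equiv 1,\] and furthermore \[2\sum_{(i,i)\in P}\mathbb{1}_{(i,i)}-2\sum_{(i,i+1)\in P}\mathbb{1}_{(i,i+1)}\equiv 1.\]
   Context: $P$ is ordered by $(i,j)\le(i',j')$ iff $i\le i'$ and $j\le j'$. $\mathcal{J}(P)$ is the set of order ideals of $P$. For $x\in P$, $I\in\mathcal{J}(P)$: $\mathbb{1}_x(I)=1$ if $x\in I$, else $0$; $T_x^+(I)=1$ if $x$ is a minimal element of $P\setminus I$, else $0$; $T_x^-(I)=1$ if $x$ is a maximal element of $I$, else $0$; $T_x=T_x^+-T_x^-$. For $f,g\colon\mathcal{J}(P)\to\mathbb{R}$, $f\equiv g$ means $f-g=\sum_{x\in P}c_xT_x$ for some real constants $c_x$; a real number denotes the corresponding constant function. -}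

module Defs where

open import Data.Bool using (Bool; true; if_then_else_)
import Data.Bool.Properties as Bool
open import Data.Integer using (+_)
open import Data.List using (List; filter; cartesianProduct; upTo; foldr; map)
open import Data.List.Membership.Propositional using (_∈_)
open import Data.List.Membership.Propositional.Properties
  using (∈-filter⁺; ∈-cartesianProduct⁺; ∈-upTo⁺)
import Data.List.Relation.Unary.All as All
open import Data.Nat as ℕ using (ℕ; suc; s≤s)
import Data.Nat.Properties as ℕ
open import Data.Product using (Σ-syntax; ∃-syntax; _×_; _,_)
open import Data.Product.Properties using (≡-dec)
open import Data.Product.Relation.Binary.Pointwise.NonDependent using (Pointwise; ×-decidable)
open import Data.Rational as ℚ using (ℚ; 0ℚ; 1ℚ; ½; ∣_∣)
import Data.Rational.Properties as ℚ
open import Data.Rational.Solver using (module +-*-Solver)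
open import Relation.Binary.PropositionalEquality
open import Relation.Nullary.Decidable
  using (Dec; does; map′; ¬?; _×-dec_; _→-dec_)
open import Relation.Nullary.Negation using (¬_)

------------------------------------------------------------------------
-- Real numbers: Cauchy sequences of rationals, with two sequences equal
-- (_≃_) when their difference tends to 0.

IsCauchy : (ℕ → ℚ) → Set
IsCauchy x = ∀ ε → 0ℚ ℚ.< ε →
  ∃[ N ] ∀ m n → N ℕ.≤ m → N ℕ.≤ n → ∣ x m ℚ.- x n ∣ ℚ.< ε

record ℝ : Set where
  constructor real
  field
    seq    : ℕ → ℚ
    cauchy : IsCauchy seq

open ℝ public

infix 4 _≃_

_≃_ : ℝ → ℝ → Set
x ≃ y = ∀ ε → 0ℚ ℚ.< ε → ∃[ N ] ∀ n → N ℕ.≤ n → ∣ seq x n ℚ.- seq y n ∣ ℚ.< ε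

fromℚ : ℚ → ℝ
fromℚ q = real (λ _ → q) λ ε 0<ε →
  0 , λ _ _ _ _ → subst (ℚ._< ε) (cong ∣_∣ (sym (ℚ.+-inverseʳ q))) 0<ε

0ℝ 1ℝ 2ℝ : ℝ
0ℝ = fromℚ 0ℚ
1ℝ = fromℚ 1ℚ
2ℝ = fromℚ (+ 2 ℚ./ 1)

private
  triangle : ∀ p q {a b} → ∣ p ∣ ℚ.< a → ∣ q ∣ ℚ.< b → ∣ p ℚ.+ q ∣ ℚ.< a ℚ.+ b
  triangle p q p<a q<b = ℚ.≤-<-trans (ℚ.∣p+q∣≤∣p∣+∣q∣ p q) (ℚ.+-mono-< p<a q<b)

  ∣*∣-bound : ∀ p q {a b} → 0ℚ ℚ.< a → ∣ p ∣ ℚ.< a → ∣ q ∣ ℚ.< b →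
              ∣ p ℚ.* q ∣ ℚ.< a ℚ.* b
  ∣*∣-bound p q {a} {b} 0<a p<a q<b = begin-strict
      ∣ p ℚ.* q ∣       ≡⟨ ℚ.∣p*q∣≡∣p∣*∣q∣ p q ⟩
      ∣ p ∣ ℚ.* ∣ q ∣   ≤⟨ ℚ.*-monoʳ-≤-nonNeg ∣ q ∣ {{ℚ.∣-∣-nonNeg q}} (ℚ.<⇒≤ p<a) ⟩
      a ℚ.* ∣ q ∣       <⟨ ℚ.*-monoʳ-<-pos a {{ℚ.positive 0<a}} q<b ⟩
      a ℚ.* b ∎
    where open ℚ.≤-Reasoning

  +-close : ∀ a b c d {δ₁ δ₂} → ∣ a ℚ.- c ∣ ℚ.< δ₁ → ∣ b ℚ.- d ∣ ℚ.< δ₂ →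
            ∣ (a ℚ.+ b) ℚ.- (c ℚ.+ d) ∣ ℚ.< δ₁ ℚ.+ δ₂
  +-close a b c d {δ₁} {δ₂} ac bd =
    subst (λ t → ∣ t ∣ ℚ.< δ₁ ℚ.+ δ₂) (sym (rearrange a b c d))
      (triangle (a ℚ.- c) (b ℚ.- d) ac bd)
    where
    rearrange : ∀ a b c d → (a ℚ.+ b) ℚ.- (c ℚ.+ d) ≡ (a ℚ.- c) ℚ.+ (b ℚ.- d)
    rearrange = solve 4 (λ a b c d →
      (a :+ b) :- (c :+ d) := (a :- c) :+ (b :- d)) refl
      where open +-*-Solver

  *-close : ∀ a b c d {A B δ} → 0ℚ ℚ.< A → 0ℚ ℚ.< B → ∣ a ∣ ℚ.< A → ∣ d ∣ ℚ.< B →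
            ∣ a ℚ.- c ∣ ℚ.< δ → ∣ b ℚ.- d ∣ ℚ.< δ →
            ∣ a ℚ.* b ℚ.- c ℚ.* d ∣ ℚ.< (A ℚ.+ B) ℚ.* δ
  *-close a b c d {A} {B} {δ} 0<A 0<B a<A d<B ac bd =
    subst₂ (λ s t → ∣ s ∣ ℚ.< t) (sym (rearrange a b c d)) (sym (ℚ.*-distribʳ-+ δ A B))
      (triangle (a ℚ.* (b ℚ.- d)) (d ℚ.* (a ℚ.- c))
        (∣*∣-bound a (b ℚ.- d) 0<A a<A bd) (∣*∣-bound d (a ℚ.- c) 0<B d<B ac))
    where
    rearrange : ∀ a b c d →
      a ℚ.* b ℚ.- c ℚ.* d ≡ a ℚ.* (b ℚ.- d) ℚ.+ d ℚ.* (a ℚ.- c)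
    rearrange = solve 4 (λ a b c d →
      a :* b :- c :* d := a :* (b :- d) :+ d :* (a :- c)) refl
      where open +-*-Solver

  scale : ∀ c ε → 0ℚ ℚ.< c → 0ℚ ℚ.< ε → ∃[ δ ] 0ℚ ℚ.< δ × c ℚ.* δ ≡ ε
  scale c ε 0<c 0<ε = c⁻¹ ℚ.* ε , 0<δ , cδ≡ε
    where
    instance
      c-pos : ℚ.Positive c
      c-pos = ℚ.positive 0<c
      c-nonZero : ℚ.NonZero c
      c-nonZero = ℚ.pos⇒nonZero c

    c⁻¹ : ℚ
    c⁻¹ = ℚ.1/ c

    0<δ : 0ℚ ℚ.< c⁻¹ ℚ.* ε
    0<δ = subst (ℚ._< c⁻¹ ℚ.* ε) (ℚ.*-zeroʳ c⁻¹)
                (ℚ.*-monoʳ-<-pos c⁻¹ {{ℚ.1/pos⇒pos c}} 0<ε)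

    cδ≡ε : c ℚ.* (c⁻¹ ℚ.* ε) ≡ ε
    cδ≡ε = trans (sym (ℚ.*-assoc c c⁻¹ ε))
      (trans (cong (ℚ._* ε) (ℚ.*-inverseʳ c)) (ℚ.*-identityˡ ε))

  +-cauchy : ∀ x y → IsCauchy x → IsCauchy y → IsCauchy (λ n → x n ℚ.+ y n)
  +-cauchy x y cx cy ε 0<ε =
    let M , hx = cx (½ ℚ.* ε) 0<½ε
        N , hy = cy (½ ℚ.* ε) 0<½ε
    in M ℕ.⊔ N , λ m n p q →
      subst (∣ (x m ℚ.+ y m) ℚ.- (x n ℚ.+ y n) ∣ ℚ.<_) half+half
        (+-close (x m) (y m) (x n) (y n)
          (hx m n (ℕ.m⊔n≤o⇒m≤o M N p) (ℕ.m⊔n≤o⇒m≤o M N q))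
          (hy m n (ℕ.m⊔n≤o⇒n≤o M N p) (ℕ.m⊔n≤o⇒n≤o M N q)))
    where
    half+half : ½ ℚ.* ε ℚ.+ ½ ℚ.* ε ≡ ε
    half+half = trans (sym (ℚ.*-distribʳ-+ ε ½ ½)) (ℚ.*-identityˡ ε)

    0<½ε : 0ℚ ℚ.< ½ ℚ.* ε
    0<½ε = subst (ℚ._< ½ ℚ.* ε) (ℚ.*-zeroʳ ½) (ℚ.*-monoʳ-<-pos ½ 0<ε)

  neg-cauchy : ∀ x → IsCauchy x → IsCauchy (λ n → ℚ.- x n)
  neg-cauchy x cx ε 0<ε =
    let N , h = cx ε 0<ε
    in N , λ m n p q → subst (ℚ._< ε) (sym (∣-∣-neg m n)) (h m n p q)
    where
    ∣-∣-neg : ∀ m n → ∣ ℚ.- x m ℚ.- (ℚ.- x n) ∣ ≡ ∣ x m ℚ.- x n ∣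
    ∣-∣-neg m n = trans (cong ∣_∣ (sym (ℚ.neg-distrib-+ (x m) (ℚ.- x n))))
                        (ℚ.∣-p∣≡∣p∣ (x m ℚ.- x n))

  eventually-bounded : ∀ x → IsCauchy x →
    ∃[ A ] 0ℚ ℚ.< A × (∃[ N ] ∀ n → N ℕ.≤ n → ∣ x n ∣ ℚ.< A)
  eventually-bounded x cx =
    let N , h = cx 1ℚ (ℚ.positive⁻¹ 1ℚ)
    in  1ℚ ℚ.+ ∣ x N ∣
      , ℚ.+-mono-<-≤ (ℚ.positive⁻¹ 1ℚ) (ℚ.0≤∣p∣ (x N))
      , N
      , λ n p → bound (x n) (x N) (h n N p ℕ.≤-refl)
    where
    split : ∀ a b → a ≡ (a ℚ.- b) ℚ.+ b
    split = solve 2 (λ a b → a := (a :- b) :+ b) refl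
      where open +-*-Solver

    bound : ∀ a b → ∣ a ℚ.- b ∣ ℚ.< 1ℚ → ∣ a ∣ ℚ.< 1ℚ ℚ.+ ∣ b ∣
    bound a b ab = begin-strict
        ∣ a ∣                     ≡⟨ cong ∣_∣ (split a b) ⟩
        ∣ (a ℚ.- b) ℚ.+ b ∣       ≤⟨ ℚ.∣p+q∣≤∣p∣+∣q∣ (a ℚ.- b) b ⟩
        ∣ a ℚ.- b ∣ ℚ.+ ∣ b ∣     <⟨ ℚ.+-monoˡ-< ∣ b ∣ ab ⟩
        1ℚ ℚ.+ ∣ b ∣ ∎
      where open ℚ.≤-Reasoning

  *-cauchy : ∀ x y → IsCauchy x → IsCauchy y → IsCauchy (λ n → x n ℚ.* y n)
  *-cauchy x y cx cy ε 0<ε =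
    let A , 0<A , K , bx    = eventually-bounded x cx
        B , 0<B , L , by    = eventually-bounded y cy
        δ , 0<δ , [A+B]δ≡ε = scale (A ℚ.+ B) ε (ℚ.+-mono-< 0<A 0<B) 0<ε
        M , hx              = cx δ 0<δ
        N , hy              = cy δ 0<δ
    in (K ℕ.⊔ L) ℕ.⊔ (M ℕ.⊔ N) , λ m n p q →
      let p₁ = ℕ.m⊔n≤o⇒m≤o (K ℕ.⊔ L) (M ℕ.⊔ N) p
          p₂ = ℕ.m⊔n≤o⇒n≤o (K ℕ.⊔ L) (M ℕ.⊔ N) p
          q₁ = ℕ.m⊔n≤o⇒m≤o (K ℕ.⊔ L) (M ℕ.⊔ N) q
          q₂ = ℕ.m⊔n≤o⇒n≤o (K ℕ.⊔ L) (M ℕ.⊔ N) q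
      in subst (∣ x m ℚ.* y m ℚ.- x n ℚ.* y n ∣ ℚ.<_) [A+B]δ≡ε
        (*-close (x m) (y m) (x n) (y n) 0<A 0<B
          (bx m (ℕ.m⊔n≤o⇒m≤o K L p₁)) (by n (ℕ.m⊔n≤o⇒n≤o K L q₁))
          (hx m n (ℕ.m⊔n≤o⇒m≤o M N p₂) (ℕ.m⊔n≤o⇒m≤o M N q₂))
          (hy m n (ℕ.m⊔n≤o⇒n≤o M N p₂) (ℕ.m⊔n≤o⇒n≤o M N q₂)))

infixl 7 _*ᴿ_
infixl 6 _+ᴿ_ _-ᴿ_
infix  8 -ᴿ_

_+ᴿ_ : ℝ → ℝ → ℝ
x +ᴿ y = real (λ n → seq x n ℚ.+ seq y n) (+-cauchy (seq x) (seq y) (cauchy x) (cauchy y))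

-ᴿ_ : ℝ → ℝ
-ᴿ x = real (λ n → ℚ.- seq x n) (neg-cauchy (seq x) (cauchy x))

_-ᴿ_ : ℝ → ℝ → ℝ
x -ᴿ y = x +ᴿ (-ᴿ y)

_*ᴿ_ : ℝ → ℝ → ℝ
x *ᴿ y = real (λ n → seq x n ℚ.* seq y n) (*-cauchy (seq x) (seq y) (cauchy x) (cauchy y))

∑ : {A : Set} → List A → (A → ℝ) → ℝ
∑ xs f = foldr _+ᴿ_ 0ℝ (map f xs)

indicator : {A : Set} → Dec A → ℝ
indicator a? = if does a? then 1ℝ else 0ℝ

------------------------------------------------------------------------
-- The root poset Φ⁺(Bₙ), as a subset of ℕ × ℕ with the product order

Cell : Set
Cell = ℕ × ℕ

infix 4 _≼_ _∈Φ⁺B_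

_≼_ : Cell → Cell → Set
_≼_ = Pointwise ℕ._≤_ ℕ._≤_

_∈Φ⁺B_ : Cell → ℕ → Set
(i , j) ∈Φ⁺B n =
  1 ℕ.≤ i × i ℕ.≤ j × j ℕ.≤ 2 ℕ.* n ℕ.∸ 1 × 2 ℕ.* n ℕ.≤ i ℕ.+ j

_∈Φ⁺B?_ : ∀ x n → Dec (x ∈Φ⁺B n)
(i , j) ∈Φ⁺B? n =
  1 ℕ.≤? i ×-dec i ℕ.≤? j ×-dec j ℕ.≤? 2 ℕ.* n ℕ.∸ 1 ×-dec 2 ℕ.* n ℕ.≤? i ℕ.+ j

-- Each element of the poset is listed exactly once.
Φ⁺B : ℕ → List Cell
Φ⁺B n = filter (_∈Φ⁺B? n) (cartesianProduct (upTo (2 ℕ.* n)) (upTo (2 ℕ.* n)))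

Φ⁺B-complete : ∀ n {x} → x ∈Φ⁺B n → x ∈ Φ⁺B n
Φ⁺B-complete n {i , j} x∈P@(1≤i , i≤j , j≤ , _) =
  ∈-filter⁺ (_∈Φ⁺B? n)
    (∈-cartesianProduct⁺ (∈-upTo⁺ (ℕ.≤-<-trans i≤j j<)) (∈-upTo⁺ j<)) x∈P
  where
  below : ∀ {j m} → 1 ℕ.≤ j → j ℕ.≤ m ℕ.∸ 1 → j ℕ.< m
  below {m = ℕ.zero} 1≤j ℕ.z≤n = 1≤j
  below {m = suc m}  _   j≤m = s≤s j≤m
  j< : j ℕ.< 2 ℕ.* n
  j< = below (ℕ.≤-trans 1≤i i≤j) j≤

∀∈Φ⁺B? : ∀ n {Q : Cell → Set} → (∀ x → Dec (Q x)) → Dec (∀ y → y ∈Φ⁺B n → Q y)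
∀∈Φ⁺B? n {Q} Q? = map′
  (λ all y y∈P → All.lookup all (Φ⁺B-complete n y∈P) y∈P)
  (λ h → All.tabulate (λ {y} _ → h y))
  (All.all? (λ y → (y ∈Φ⁺B? n) →-dec Q? y) (Φ⁺B n))

-- Subsets of the finite set P are given by characteristic functions.
record 𝒥 (n : ℕ) : Set where
  field
    member : Cell → Bool
    ⊆P     : ∀ x → member x ≡ true → x ∈Φ⁺B n
    closed : ∀ x y → x ∈Φ⁺B n → x ≼ y → member y ≡ true → member x ≡ true

open 𝒥 public

infix 4 _∈ᴵ_ _∈ᴵ?_ _≟ᶜ_ _≼?_

_∈ᴵ_ : ∀ {n} → Cell → 𝒥 n → Set
x ∈ᴵ I = member I x ≡ true

_∈ᴵ?_ : ∀ {n} x (I : 𝒥 n) → Dec (x ∈ᴵ I)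
x ∈ᴵ? I = member I x Bool.≟ true

_≟ᶜ_ : (x y : Cell) → Dec (x ≡ y)
_≟ᶜ_ = ≡-dec ℕ._≟_ ℕ._≟_

_≼?_ : (x y : Cell) → Dec (x ≼ y)
_≼?_ = ×-decidable ℕ._≤?_ ℕ._≤?_

MinimalOutside : ∀ {n} → Cell → 𝒥 n → Set
MinimalOutside {n} x I =
  x ∈Φ⁺B n × ¬ x ∈ᴵ I × (∀ y → y ∈Φ⁺B n → ¬ y ∈ᴵ I → y ≼ x → y ≡ x)

MaximalInside : ∀ {n} → Cell → 𝒥 n → Set
MaximalInside {n} x I =
  x ∈ᴵ I × (∀ y → y ∈Φ⁺B n → y ∈ᴵ I → x ≼ y → y ≡ x)

minimalOutside? : ∀ {n} x (I : 𝒥 n) → Dec (MinimalOutside x I)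
minimalOutside? {n} x I =
  (x ∈Φ⁺B? n) ×-dec ¬? (x ∈ᴵ? I) ×-dec
  ∀∈Φ⁺B? n (λ y → ¬? (y ∈ᴵ? I) →-dec (y ≼? x) →-dec (y ≟ᶜ x))

maximalInside? : ∀ {n} x (I : 𝒥 n) → Dec (MaximalInside x I)
maximalInside? {n} x I =
  (x ∈ᴵ? I) ×-dec ∀∈Φ⁺B? n (λ y → (y ∈ᴵ? I) →-dec (x ≼? y) →-dec (y ≟ᶜ x))

------------------------------------------------------------------------
-- Statistics on order ideals

𝟙 T⁺ T⁻ T : ∀ {n} → Cell → 𝒥 n → ℝ
𝟙  x I = indicator (x ∈ᴵ? I)
T⁺ x I = indicator (minimalOutside? x I)
T⁻ x I = indicator (maximalInside? x I)
T  x I = T⁺ x I -ᴿ T⁻ x I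

infix 4 _≡ᵀ_

-- Only the values of c on P matter.
_≡ᵀ_ : ∀ {n} → (𝒥 n → ℝ) → (𝒥 n → ℝ) → Set
_≡ᵀ_ {n} f g = Σ[ c ∈ (Cell → ℝ) ]
  ∀ (I : 𝒥 n) → f I -ᴿ g I ≃ ∑ (Φ⁺B n) (λ x → c x *ᴿ T x I)

-- The sum of 𝟙 (i , j) over (i , j) ∈ P with j - i = d; truncated
-- subtraction is harmless since i ≤ j on P.
∑𝟙-diagonal : ∀ {n} → ℕ → 𝒥 n → ℝ
∑𝟙-diagonal {n} d I =
  ∑ (filter (λ (i , j) → j ℕ.∸ i ℕ.≟ d) (Φ⁺B n)) (λ x → 𝟙 x I)

{-# OPTIONS --safe #-}
-- Let k be even. For x = (i , i + k) let a = (i , i + k + 1), and let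
-- b = (i + 1 , i + k), reflected to a if k = 0. Let uᵢ ∈ {0 , 1} say that all
-- lower neighbours of x in P lie in I. By inclusion–exclusion on the upper
-- neighbours a and b,
--   T x = uᵢ - 2 𝟙 x + 𝟙 a + 𝟙 b - uᵢ₊₁,
-- since a and b are also the lower neighbours of (i + 1 , i + k + 1). Summing
-- over the diagonal, the uᵢ telescope to u₀ - u₂ₙ = 1 - 0. So c is -1 on the
-- diagonal j - i = k, and 0 elsewhere.

module Submission where

open import Defs
open import Data.Nat using (ℕ; _+_; _*_; _∸_; _≤_)
open import Data.Nat.Divisibility using (_∣_)
open import Data.Product using (_×_)

open import Data.Bool using (Bool; true; false; if_then_else_; not; _∧_; _∨_)
import Data.Bool.Properties as Bool
open import Data.Empty using (⊥-elim)
import Data.Integer as ℤ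
open import Data.List using (List; []; _∷_; _++_; filter; foldr; map; cartesianProduct; applyUpTo; upTo)
open import Data.Nat using (zero; suc; s≤s; z≤n; _<_)
open import Data.Nat.Divisibility using (divides)
import Data.Nat.Properties as ℕ
import Data.Nat.Solver as ℕSolver
open import Data.Product using (_,_; proj₁; proj₂)
open import Data.Rational as ℚ using (ℚ; 0ℚ; 1ℚ; ∣_∣)
import Data.Rational.Properties as ℚ
open import Data.Rational.Solver using (module +-*-Solver)
open import Data.Sum using (_⊎_; inj₁; inj₂)
open import Function using (_∘_; case_of_)
open import Relation.Binary.PropositionalEquality
open import Relation.Nullary.Decidable using (Dec; yes; no; does; dec-true; dec-false; decidable-stable)
open import Relation.Nullary.Negation using (¬_)
open import Relation.Unary using (Decidable)

-- Finite sums of rationals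

sum : {A : Set} → List A → (A → ℚ) → ℚ
sum xs f = foldr ℚ._+_ 0ℚ (map f xs)

sum-cong : {A : Set} (xs : List A) {f g : A → ℚ} → (∀ x → f x ≡ g x) → sum xs f ≡ sum xs g
sum-cong []       f≡g = refl
sum-cong (x ∷ xs) f≡g = cong₂ ℚ._+_ (f≡g x) (sum-cong xs f≡g)

sum-neg : {A : Set} (xs : List A) (f : A → ℚ) → sum xs (λ x → ℚ.- f x) ≡ ℚ.- sum xs f
sum-neg []       f = refl
sum-neg (x ∷ xs) f =
  trans (cong (ℚ.- f x ℚ.+_) (sum-neg xs f)) (sym (ℚ.neg-distrib-+ (f x) (sum xs f)))

sum-++ : {A : Set} (xs ys : List A) (f : A → ℚ) → sum (xs ++ ys) f ≡ sum xs f ℚ.+ sum ys f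
sum-++ []       ys f = sym (ℚ.+-identityˡ _)
sum-++ (x ∷ xs) ys f = trans (cong (f x ℚ.+_) (sum-++ xs ys f)) (sym (ℚ.+-assoc (f x) _ _))

sum-map : {A B : Set} (g : A → B) (xs : List A) (f : B → ℚ) → sum (map g xs) f ≡ sum xs (f ∘ g)
sum-map g []       f = refl
sum-map g (x ∷ xs) f = cong (f (g x) ℚ.+_) (sum-map g xs f)

sum-filter : {A : Set} {P : A → Set} (P? : Decidable P) (xs : List A) (f : A → ℚ) →
             sum (filter P? xs) f ≡ sum xs (λ x → if does (P? x) then f x else 0ℚ)
sum-filter P? []       f = refl
sum-filter P? (x ∷ xs) f with does (P? x)
... | true  = cong (f x ℚ.+_) (sum-filter P? xs f)
... | false = trans (sum-filter P? xs f) (sym (ℚ.+-identityˡ _))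

sum-cartesianProduct : {A B : Set} (xs : List A) (ys : List B) (f : A × B → ℚ) →
                       sum (cartesianProduct xs ys) f ≡ sum xs (λ x → sum ys (λ y → f (x , y)))
sum-cartesianProduct []       ys f = refl
sum-cartesianProduct (x ∷ xs) ys f =
  trans (sum-++ (map (x ,_) ys) (cartesianProduct xs ys) f)
        (cong₂ ℚ._+_ (sum-map (x ,_) ys f) (sum-cartesianProduct xs ys f))

sum< : ℕ → (ℕ → ℚ) → ℚ
sum< zero    f = 0ℚ
sum< (suc N) f = f 0 ℚ.+ sum< N (f ∘ suc)

sum<-cong : ∀ N {f g : ℕ → ℚ} → (∀ i → f i ≡ g i) → sum< N f ≡ sum< N g
sum<-cong zero    f≡g = refl
sum<-cong (suc N) f≡g = cong₂ ℚ._+_ (f≡g 0) (sum<-cong N (f≡g ∘ suc))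

sum-applyUpTo : {A : Set} (g : ℕ → A) (N : ℕ) (f : A → ℚ) →
                sum (applyUpTo g N) f ≡ sum< N (f ∘ g)
sum-applyUpTo g zero    f = refl
sum-applyUpTo g (suc N) f = cong (f (g 0) ℚ.+_) (sum-applyUpTo (g ∘ suc) N f)

sum<-zero : ∀ N {f : ℕ → ℚ} → (∀ i → f i ≡ 0ℚ) → sum< N f ≡ 0ℚ
sum<-zero zero    f≡0 = refl
sum<-zero (suc N) f≡0 = cong₂ ℚ._+_ (f≡0 0) (sum<-zero N (f≡0 ∘ suc))

-- If `a` lies outside the range, every summand is zero, and the last hypothesis makes `f a` zero as
-- well.
sum<-single : ∀ N a (f : ℕ → ℚ) → (∀ i → i ≢ a → f i ≡ 0ℚ) → (N ≤ a → f a ≡ 0ℚ) →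
              sum< N f ≡ f a
sum<-single zero    a       f f≡0 fa≡0 = sym (fa≡0 z≤n)
sum<-single (suc N) zero    f f≡0 fa≡0 =
  trans (cong (f 0 ℚ.+_) (sum<-zero N (λ i → f≡0 (suc i) (λ ())))) (ℚ.+-identityʳ (f 0))
sum<-single (suc N) (suc a) f f≡0 fa≡0 =
  trans (cong₂ ℚ._+_ (f≡0 0 (λ ()))
          (sum<-single N a (f ∘ suc) (λ i i≢a → f≡0 (suc i) (i≢a ∘ ℕ.suc-injective))
            (fa≡0 ∘ s≤s)))
        (ℚ.+-identityˡ _)

-- Both sides arise from the sum over `0 , … , N` by dropping one end term, and both end terms
-- vanish.
sum<-shift : ∀ N (f : ℕ → ℚ) → f 0 ≡ 0ℚ → f N ≡ 0ℚ → sum< N (f ∘ suc) ≡ sum< N f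
sum<-shift N f f0≡0 fN≡0 = begin
    sum< N (f ∘ suc)            ≡⟨ sym (ℚ.+-identityˡ _) ⟩
    0ℚ ℚ.+ sum< N (f ∘ suc)     ≡⟨ cong (ℚ._+ sum< N (f ∘ suc)) (sym f0≡0) ⟩
    f 0 ℚ.+ sum< N (f ∘ suc)    ≡⟨ snoc N f ⟩
    sum< N f ℚ.+ f N            ≡⟨ cong (sum< N f ℚ.+_) fN≡0 ⟩
    sum< N f ℚ.+ 0ℚ             ≡⟨ ℚ.+-identityʳ _ ⟩
    sum< N f                    ∎
  where
  open ≡-Reasoning
  snoc : ∀ N (f : ℕ → ℚ) → sum< (suc N) f ≡ sum< N f ℚ.+ f N
  snoc zero    f = ℚ.+-comm (f 0) 0ℚ
  snoc (suc N) f = trans (cong (f 0 ℚ.+_) (snoc N (f ∘ suc))) (sym (ℚ.+-assoc (f 0) _ _))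

2ℚ : ℚ
2ℚ = ℤ.+ 2 ℚ./ 1

-- Only the `u` terms cancel in consecutive pairs; the `x`, `a` and `b` terms accumulate.
sum<-telescope : ∀ N (t u x a b : ℕ → ℚ) →
  (∀ i → t i ≡ u i ℚ.- 2ℚ ℚ.* x i ℚ.+ a i ℚ.+ b i ℚ.- u (suc i)) →
  sum< N t ≡ u 0 ℚ.- 2ℚ ℚ.* sum< N x ℚ.+ sum< N a ℚ.+ sum< N b ℚ.- u N
sum<-telescope zero t u x a b step =
  solve 1 (λ v → con 0ℚ := v :- con 2ℚ :* con 0ℚ :+ con 0ℚ :+ con 0ℚ :- v) refl (u 0)
  where open +-*-Solver using (solve; _:=_; _:+_; _:*_; _:-_; :-_; con)
sum<-telescope (suc N) t u x a b step =
  trans (cong₂ ℚ._+_ (step 0)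
          (sum<-telescope N (t ∘ suc) (u ∘ suc) (x ∘ suc) (a ∘ suc) (b ∘ suc) (step ∘ suc)))
        (solve 9 (λ u₀ u₁ uₙ x xs a as b bs →
            (u₀ :- con 2ℚ :* x :+ a :+ b :- u₁) :+ (u₁ :- con 2ℚ :* xs :+ as :+ bs :- uₙ)
            := u₀ :- con 2ℚ :* (x :+ xs) :+ (a :+ as) :+ (b :+ bs) :- uₙ)
          refl (u 0) (u 1) (u (suc N)) (x 0) (sum< N (x ∘ suc)) (a 0) (sum< N (a ∘ suc))
          (b 0) (sum< N (b ∘ suc)))
  where open +-*-Solver using (solve; _:=_; _:+_; _:*_; _:-_; :-_; con)

-- From Cauchy sequences to rationals

⟦_⟧ : Bool → ℚ
⟦ b ⟧ = if b then 1ℚ else 0ℚ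

seq-∑ : {A : Set} (xs : List A) (f : A → ℝ) (m : ℕ) → seq (∑ xs f) m ≡ sum xs (λ x → seq (f x) m)
seq-∑ []       f m = refl
seq-∑ (x ∷ xs) f m = cong (seq (f x) m ℚ.+_) (seq-∑ xs f m)

seq-indicator : {A : Set} (a? : Dec A) (m : ℕ) → seq (indicator a?) m ≡ ⟦ does a? ⟧
seq-indicator a? m with does a?
... | true  = refl
... | false = refl

-- The differences are exactly zero, so the index 0 serves for every ε.
seq≡⇒≃ : (x y : ℝ) → (∀ m → seq x m ≡ seq y m) → x ≃ y
seq≡⇒≃ x y x≡y ε 0<ε = 0 , λ m _ →
  subst (ℚ._< ε) (cong ∣_∣ (sym (trans (cong (ℚ._- seq y m) (x≡y m)) (ℚ.+-inverseʳ (seq y m))))) 0<ε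

-- Diagonals of the root poset

∈Φ⁺B⇒< : ∀ n {i j} → (i , j) ∈Φ⁺B n → j < 2 * n
∈Φ⁺B⇒< n (1≤i , i≤j , j≤ , _) = below (2 * n) (ℕ.≤-trans 1≤i i≤j) j≤
  where
  below : ∀ m {j} → 1 ≤ j → j ≤ m ∸ 1 → j < m
  below zero    1≤j z≤n = 1≤j
  below (suc m) _   j≤m = s≤s j≤m

mk∈Φ⁺B : ∀ n {i j} → 1 ≤ i → i ≤ j → j < 2 * n → 2 * n ≤ i + j → (i , j) ∈Φ⁺B n
mk∈Φ⁺B n 1≤i i≤j j< 2n≤ = 1≤i , i≤j , ℕ.<⇒≤pred j< , 2n≤

sum-diagonal : ∀ n d (f : Cell → ℚ) → (∀ x → ¬ x ∈Φ⁺B n → f x ≡ 0ℚ) →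
  sum (filter (λ (i , j) → j ∸ i ℕ.≟ d) (Φ⁺B n)) f ≡ sum< (2 * n) (λ i → f (i , i + d))
sum-diagonal n d f f≡0 = begin
    sum (filter diag? (Φ⁺B n)) f
      ≡⟨ sum-filter diag? (Φ⁺B n) f ⟩
    sum (Φ⁺B n) g
      ≡⟨ sum-filter (_∈Φ⁺B? n) (cartesianProduct (upTo N) (upTo N)) g ⟩
    sum (cartesianProduct (upTo N) (upTo N)) (λ x → if does (x ∈Φ⁺B? n) then g x else 0ℚ)
      ≡⟨ sum-cong (cartesianProduct (upTo N) (upTo N)) drop-∈P ⟩
    sum (cartesianProduct (upTo N) (upTo N)) g
      ≡⟨ sum-cartesianProduct (upTo N) (upTo N) g ⟩
    sum (upTo N) (λ i → sum (upTo N) (λ j → g (i , j)))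
      ≡⟨ sum-applyUpTo _ N _ ⟩
    sum< N (λ i → sum (upTo N) (λ j → g (i , j)))
      ≡⟨ sum<-cong N (λ i → sum-applyUpTo _ N _) ⟩
    sum< N (λ i → sum< N (λ j → g (i , j)))
      ≡⟨ sum<-cong N (λ i → trans (sum<-single N (i + d) (λ j → g (i , j)) (off i) (out i)) (on i)) ⟩
    sum< N (λ i → f (i , i + d)) ∎
  where
  open ≡-Reasoning
  N : ℕ
  N = 2 * n

  diag? : Decidable {A = Cell} (λ (i , j) → j ∸ i ≡ d)
  diag? (i , j) = j ∸ i ℕ.≟ d

  g : Cell → ℚ
  g x = if does (diag? x) then f x else 0ℚ

  g≡0 : ∀ x → ¬ x ∈Φ⁺B n → g x ≡ 0ℚ
  g≡0 x x∉P with does (diag? x)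
  ... | true  = f≡0 x x∉P
  ... | false = refl

  drop-∈P : ∀ x → (if does (x ∈Φ⁺B? n) then g x else 0ℚ) ≡ g x
  drop-∈P x with x ∈Φ⁺B? n
  ... | yes x∈P rewrite dec-true (x ∈Φ⁺B? n) x∈P = refl
  ... | no  x∉P rewrite dec-false (x ∈Φ⁺B? n) x∉P = sym (g≡0 x x∉P)

  on : ∀ i → g (i , i + d) ≡ f (i , i + d)
  on i rewrite dec-true (diag? (i , i + d)) (ℕ.m+n∸m≡n i d) = refl

  off : ∀ i j → j ≢ i + d → g (i , j) ≡ 0ℚ
  off i j j≢ with diag? (i , j)
  ... | no  j∸i≢d rewrite dec-false (diag? (i , j)) j∸i≢d = refl
  -- Here the subtraction was truncated: if `i ≤ j` held, `j ∸ i ≡ d` would force `j ≡ i + d`. So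
  -- the cell is not in P.
  ... | yes j∸i≡d = g≡0 (i , j) λ (_ , i≤j , _) →
    j≢ (trans (sym (ℕ.m+[n∸m]≡n i≤j)) (cong (i +_) j∸i≡d))

  out : ∀ i → N ≤ i + d → g (i , i + d) ≡ 0ℚ
  out i N≤ = g≡0 (i , i + d) λ x∈P → ℕ.<⇒≱ (∈Φ⁺B⇒< n x∈P) N≤

-- Upper neighbours of (i , i + k); for k = 0 the cell (i + 1 , i) lies below
-- the diagonal and is reflected.

upʲ upⁱ : ℕ → ℕ → Cell
upʲ k i = i , suc (i + k)
upⁱ zero      i = i , suc (i + 0)
upⁱ k@(suc _) i = suc i , i + k

diag : ℕ → ℕ → Cell
diag k i = i , i + k

diag≼upʲ : ∀ k i → diag k i ≼ upʲ k i
diag≼upʲ k i = ℕ.≤-refl , ℕ.n≤1+n _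

diag≼upⁱ : ∀ k i → diag k i ≼ upⁱ k i
diag≼upⁱ zero    i = diag≼upʲ zero i
diag≼upⁱ (suc k) i = ℕ.n≤1+n i , ℕ.≤-refl

upʲ≼diag : ∀ k i → upʲ k i ≼ diag k (suc i)
upʲ≼diag k i = ℕ.n≤1+n i , ℕ.≤-refl

upⁱ≼diag : ∀ k i → upⁱ k i ≼ diag k (suc i)
upⁱ≼diag zero    i = upʲ≼diag zero i
upⁱ≼diag (suc k) i = ℕ.≤-refl , ℕ.n≤1+n _

upʲ≢diag : ∀ k i → upʲ k i ≢ diag k i
upʲ≢diag k i = ℕ.1+n≢n ∘ cong proj₂

upⁱ≢diag : ∀ k i → upⁱ k i ≢ diag k i
upⁱ≢diag zero    i = ℕ.1+n≢n ∘ cong proj₂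
upⁱ≢diag (suc k) i = ℕ.1+n≢n ∘ cong proj₁

upʲ≢diag-suc : ∀ k i → upʲ k i ≢ diag k (suc i)
upʲ≢diag-suc k i = ℕ.1+n≢n ∘ sym ∘ cong proj₁

upⁱ≢diag-suc : ∀ k i → upⁱ k i ≢ diag k (suc i)
upⁱ≢diag-suc zero    i = ℕ.1+n≢n ∘ sym ∘ cong proj₁
upⁱ≢diag-suc (suc k) i = ℕ.1+n≢n ∘ sym ∘ cong proj₂

-- Either the second coordinate grows, or it stays at `i + k` and the first one grows. For `k = 0`
-- the latter would give `y₁ > y₂`, which P excludes.
above-diag : ∀ n k i y → y ∈Φ⁺B n → diag k i ≼ y → y ≢ diag k i → upʲ k i ≼ y ⊎ upⁱ k i ≼ y
above-diag n k i (y₁ , y₂) (_ , y₁≤y₂ , _) (i≤y₁ , i+k≤y₂) y≢ with i + k ℕ.<? y₂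
... | yes i+k<y₂ = inj₁ (i≤y₁ , i+k<y₂)
... | no  i+k≮y₂ = inj₂ (go k i+k≤y₂ y₂≡ )
  where
  y₂≡ : y₂ ≡ i + k
  y₂≡ = ℕ.≤-antisym (ℕ.≮⇒≥ i+k≮y₂) i+k≤y₂
  i<y₁ : i < y₁
  i<y₁ = ℕ.≤∧≢⇒< i≤y₁ λ i≡y₁ → y≢ (cong₂ _,_ (sym i≡y₁) y₂≡)
  go : ∀ k → i + k ≤ y₂ → y₂ ≡ i + k → upⁱ k i ≼ (y₁ , y₂)
  go (suc k) le _  = i<y₁ , le
  go zero    _  eq = ⊥-elim (ℕ.<⇒≱ i<y₁ (subst (y₁ ≤_) (trans eq (ℕ.+-identityʳ i)) y₁≤y₂))

-- Dual to `above-diag`: either the first coordinate drops, or it stays at `i + 1` and the second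
-- one drops, which for `k = 0` would again give `y₁ > y₂`.
below-diag : ∀ n k i y → y ∈Φ⁺B n → y ≼ diag k (suc i) → y ≢ diag k (suc i) →
             y ≼ upʲ k i ⊎ y ≼ upⁱ k i
below-diag n k i (y₁ , y₂) (_ , y₁≤y₂ , _) (y₁≤ , y₂≤) y≢ with y₁ ℕ.≤? i
... | yes y₁≤i = inj₁ (y₁≤i , y₂≤)
... | no  y₁≰i = inj₂ (go k y₂<)
  where
  y₁≡ : y₁ ≡ suc i
  y₁≡ = ℕ.≤-antisym y₁≤ (ℕ.≰⇒> y₁≰i)
  y₂< : y₂ < suc i + k
  y₂< = ℕ.≤∧≢⇒< y₂≤ λ y₂≡ → y≢ (cong₂ _,_ y₁≡ y₂≡)
  go : ∀ k → y₂ < suc i + k → (y₁ , y₂) ≼ upⁱ k i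
  go (suc k) lt = y₁≤ , ℕ.≤-pred lt
  go zero    lt = ⊥-elim (ℕ.<⇒≱ (ℕ.≤-<-trans y₁≤y₂ lt)
    (ℕ.≤-reflexive (trans (ℕ.+-identityʳ (suc i)) (sym y₁≡))))

-- The lower bounds come from `x` and the upper bound from `y`. The inequality between the
-- coordinates of `z` is a separate hypothesis, because `(i + 1 , i)` lies between `(i , i)` and
-- `(i + 1 , i + 1)`.
interval : ∀ n {x y z} → x ∈Φ⁺B n → y ∈Φ⁺B n → x ≼ z → z ≼ y → proj₁ z ≤ proj₂ z → z ∈Φ⁺B n
interval n (1≤i , _ , _ , 2n≤) (_ , _ , j≤ , _) (p , q) (_ , s) i≤j =
  ℕ.≤-trans 1≤i p , i≤j , ℕ.≤-trans s j≤ , ℕ.≤-trans 2n≤ (ℕ.+-mono-≤ p q)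

upʲ-ordered : ∀ k i → proj₁ (upʲ k i) ≤ proj₂ (upʲ k i)
upʲ-ordered k i = ℕ.m≤n⇒m≤1+n (ℕ.m≤m+n i k)

upⁱ-ordered : ∀ k i → proj₁ (upⁱ k i) ≤ proj₂ (upⁱ k i)
upⁱ-ordered zero    i = upʲ-ordered zero i
upⁱ-ordered (suc k) i = subst (suc i ≤_) (sym (ℕ.+-suc i k)) (s≤s (ℕ.m≤m+n i k))

-- The rank function of P up to a shift: covers raise it by one, and the minimal elements of P have
-- level `2 * n`.
level : Cell → ℕ
level (i , j) = i + j

level-upʲ : ∀ k i → level (upʲ k i) ≡ suc (level (diag k i))
level-upʲ k i = ℕ.+-suc i (i + k)

level-upⁱ : ∀ k i → level (upⁱ k i) ≡ suc (level (diag k i))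
level-upⁱ zero    i = level-upʲ zero i
level-upⁱ (suc k) i = refl

level-diag-suc : ∀ k i → level (diag k (suc i)) ≡ suc (suc (level (diag k i)))
level-diag-suc k i = cong suc (ℕ.+-suc i (i + k))

≡true⇒does≡ : {A : Set} (a? : Dec A) {b : Bool} → (A → b ≡ true) → (b ≡ true → A) → does a? ≡ b
≡true⇒does≡ (yes a) {b}     to from = sym (to a)
≡true⇒does≡ (no ¬a) {true}  to from = ⊥-elim (¬a (from refl))
≡true⇒does≡ (no ¬a) {false} to from = refl

-- Toggle conditions in terms of neighbours

module _ {n : ℕ} (I : 𝒥 n) where

  ∉P⇒≡false : ∀ x → ¬ x ∈Φ⁺B n → member I x ≡ false
  ∉P⇒≡false x x∉P = Bool.¬-not (x∉P ∘ ⊆P I x)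

  T⁺-∉P : ∀ x → ¬ x ∈Φ⁺B n → does (minimalOutside? x I) ≡ false
  T⁺-∉P x x∉P = dec-false (minimalOutside? x I) (x∉P ∘ proj₁)

  T⁻-∉P : ∀ x → ¬ x ∈Φ⁺B n → does (maximalInside? x I) ≡ false
  T⁻-∉P x x∉P = dec-false (maximalInside? x I) (x∉P ∘ ⊆P I x ∘ proj₁)

  -- On P this says that the lower neighbours of (i , i + k) in P lie in I.
  lower⊆I : ℕ → ℕ → Bool
  lower⊆I k zero    = true
  lower⊆I k (suc i) =
    does (level (diag k (suc i)) ℕ.≤? 2 * n) ∨ (member I (upʲ k i) ∧ member I (upⁱ k i))

  lower⊆I-low : ∀ k i → level (diag k (suc i)) ≤ 2 * n → lower⊆I k (suc i) ≡ true
  lower⊆I-low k i ≤2n rewrite dec-true (level (diag k (suc i)) ℕ.≤? 2 * n) ≤2n = refl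

  lower⊆I-high : ∀ k i → 2 * n < level (diag k (suc i)) →
                 lower⊆I k (suc i) ≡ member I (upʲ k i) ∧ member I (upⁱ k i)
  lower⊆I-high k i 2n<
    rewrite dec-false (level (diag k (suc i)) ℕ.≤? 2 * n) (ℕ.<⇒≱ 2n<) = refl

  MaximalInside⇒upper∉I : ∀ {x y} → MaximalInside x I → x ≼ y → y ≢ x → member I y ≡ false
  MaximalInside⇒upper∉I {y = y} (_ , max) x≼y y≢x =
    Bool.¬-not λ y∈I → y≢x (max y (⊆P I y y∈I) y∈I x≼y)

  MinimalOutside⇒lower∈I : ∀ {x y} → MinimalOutside x I → y ∈Φ⁺B n → y ≼ x → y ≢ x → y ∈ᴵ I
  MinimalOutside⇒lower∈I {y = y} (_ , _ , min) y∈P y≼x y≢x =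
    decidable-stable (y ∈ᴵ? I) λ y∉I → y≢x (min y y∈P y∉I y≼x)

  -- By `above-diag`, an element of `I` strictly above the cell lies above one of the two upper
  -- neighbours. That neighbour is in P by convexity, hence in `I`, since `I` is an ideal.
  maximalInside≡ : ∀ k i → does (maximalInside? (diag k i) I) ≡
    member I (diag k i) ∧ not (member I (upʲ k i) ∨ member I (upⁱ k i))
  maximalInside≡ k i = ≡true⇒does≡ (maximalInside? x I) to from
    where
    x : Cell
    x = diag k i

    to : MaximalInside x I → member I x ∧ not (member I (upʲ k i) ∨ member I (upⁱ k i)) ≡ true
    to m = cong₂ (λ a b → a ∧ not b) (proj₁ m)
      (cong₂ _∨_ (MaximalInside⇒upper∉I m (diag≼upʲ k i) (upʲ≢diag k i))
                 (MaximalInside⇒upper∉I m (diag≼upⁱ k i) (upⁱ≢diag k i)))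

    from : member I x ∧ not (member I (upʲ k i) ∨ member I (upⁱ k i)) ≡ true → MaximalInside x I
    from h with member I x in x∈I | member I (upʲ k i) in a∉I | member I (upⁱ k i) in b∉I
    from () | false | _     | _
    from () | true  | true  | _
    from () | true  | false | true
    from h  | true  | false | false = refl , max
      where
      max : ∀ y → y ∈Φ⁺B n → y ∈ᴵ I → x ≼ y → y ≡ x
      max y y∈P y∈I x≼y = decidable-stable (y ≟ᶜ x) λ y≢x →
        case above-diag n k i y y∈P x≼y y≢x of λ where
          (inj₁ a≼y) → Bool.not-¬ a∉I (closed I _ y
            (interval n (⊆P I x x∈I) y∈P (diag≼upʲ k i) a≼y (upʲ-ordered k i)) a≼y y∈I)
          (inj₂ b≼y) → Bool.not-¬ b∉I (closed I _ y
            (interval n (⊆P I x x∈I) y∈P (diag≼upⁱ k i) b≼y (upⁱ-ordered k i)) b≼y y∈I)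

  -- A strict drop in either coordinate would put `y` at a level below `2 * n`, outside P.
  minimal-level : ∀ {x y} → y ∈Φ⁺B n → level x ≤ 2 * n → y ≼ x → y ≡ x
  minimal-level {i , j} {i′ , j′} (_ , _ , _ , 2n≤) ≤2n (p , q) =
    cong₂ _,_
      (ℕ.≤-antisym p (ℕ.≮⇒≥ λ lt → ℕ.<⇒≱ (ℕ.+-mono-<-≤ lt q) (ℕ.≤-trans ≤2n 2n≤)))
      (ℕ.≤-antisym q (ℕ.≮⇒≥ λ lt → ℕ.<⇒≱ (ℕ.+-mono-≤-< p lt) (ℕ.≤-trans ≤2n 2n≤)))

  module _ (k i : ℕ) (x∈P : diag k (suc i) ∈Φ⁺B n) where

    private
      x : Cell
      x = diag k (suc i)

    module _ (2n< : 2 * n < level x) where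

      private
        -- At `i = 0` the level of `x` is one more than its second coordinate, which is below
        -- `2 * n`, so the level could not exceed `2 * n`.
        1≤i : 1 ≤ i
        1≤i = ℕ.n≢0⇒n>0 λ { refl → ℕ.<⇒≱ 2n< (∈Φ⁺B⇒< n x∈P) }

        j<2n : suc (i + k) < 2 * n
        j<2n = ∈Φ⁺B⇒< n x∈P

        2n≤ : 2 * n ≤ suc (level (diag k i))
        2n≤ = ℕ.≤-pred (subst (2 * n <_) (level-diag-suc k i) 2n<)

      -- The neighbour is one level below `x`, so its level is still at least `2 * n`.
      upʲ∈P : upʲ k i ∈Φ⁺B n
      upʲ∈P = mk∈Φ⁺B n 1≤i (upʲ-ordered k i) j<2n (subst (2 * n ≤_) (sym (level-upʲ k i)) 2n≤)

      upⁱ∈P : upⁱ k i ∈Φ⁺B n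
      upⁱ∈P = mk∈Φ⁺B n (ℕ.≤-trans 1≤i (proj₁ (diag≼upⁱ k i))) (upⁱ-ordered k i)
        (ℕ.≤-<-trans (proj₂ (upⁱ≼diag k i)) j<2n) (subst (2 * n ≤_) (sym (level-upⁱ k i)) 2n≤)

    diag∈I⇒lower⊆I : x ∈ᴵ I → lower⊆I k (suc i) ≡ true
    diag∈I⇒lower⊆I x∈I with level x ℕ.≤? 2 * n
    ... | yes ≤2n = lower⊆I-low k i ≤2n
    ... | no  ≰2n = trans (lower⊆I-high k i 2n<)
      (cong₂ _∧_ (closed I _ x (upʲ∈P 2n<) (upʲ≼diag k i) x∈I)
                 (closed I _ x (upⁱ∈P 2n<) (upⁱ≼diag k i) x∈I))
      where
      2n< : 2 * n < level x
      2n< = ℕ.≰⇒> ≰2n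

    -- At level `2 * n` no element of P lies strictly below `x`, so only `x ∉ I` matters. At higher
    -- levels both lower neighbours belong to P, and by `below-diag` every smaller element of P lies
    -- below one of them.
    minimalOutside≡ : does (minimalOutside? x I) ≡ lower⊆I k (suc i) ∧ not (member I x)
    minimalOutside≡ with level x ℕ.≤? 2 * n
    ... | yes ≤2n = trans (≡true⇒does≡ (minimalOutside? x I)
        (λ (_ , x∉I , _) → cong not (Bool.¬-not x∉I))
        (λ h → x∈P , Bool.not-¬ (Bool.not-injective h) , λ y y∈P _ → minimal-level y∈P ≤2n))
      (sym (cong (_∧ not (member I x)) (lower⊆I-low k i ≤2n)))
    ... | no  ≰2n = trans (≡true⇒does≡ (minimalOutside? x I) to from)
      (sym (cong (_∧ not (member I x)) (lower⊆I-high k i 2n<)))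
      where
      2n< : 2 * n < level x
      2n< = ℕ.≰⇒> ≰2n

      to : MinimalOutside x I →
           (member I (upʲ k i) ∧ member I (upⁱ k i)) ∧ not (member I x) ≡ true
      to m = cong₂ _∧_
        (cong₂ _∧_ (MinimalOutside⇒lower∈I m (upʲ∈P 2n<) (upʲ≼diag k i) (upʲ≢diag-suc k i))
                   (MinimalOutside⇒lower∈I m (upⁱ∈P 2n<) (upⁱ≼diag k i) (upⁱ≢diag-suc k i)))
        (cong not (Bool.¬-not (proj₁ (proj₂ m))))

      from : (member I (upʲ k i) ∧ member I (upⁱ k i)) ∧ not (member I x) ≡ true →
             MinimalOutside x I
      from h with member I (upʲ k i) in a∈I | member I (upⁱ k i) in b∈I | member I x in x∉I
      from () | false | _     | _
      from () | true  | false | _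
      from () | true  | true  | true
      from h  | true  | true  | false = x∈P , (λ ()) , min
        where
        min : ∀ y → y ∈Φ⁺B n → ¬ y ∈ᴵ I → y ≼ x → y ≡ x
        min y y∈P y∉I y≼x = decidable-stable (y ≟ᶜ x) λ y≢x →
          case below-diag n k i y y∈P y≼x y≢x of λ where
            (inj₁ y≼a) → y∉I (closed I y _ y∈P y≼a a∈I)
            (inj₂ y≼b) → y∉I (closed I y _ y∈P y≼b b∈I)

-- Toggles as linear combinations of indicators

combination : (u x a b u′ : Bool) → ℚ
combination u x a b u′ = ⟦ u ⟧ ℚ.- 2ℚ ℚ.* ⟦ x ⟧ ℚ.+ ⟦ a ⟧ ℚ.+ ⟦ b ⟧ ℚ.- ⟦ u′ ⟧

combination-cong : ∀ {u v x y a c b d u′ v′} → u ≡ v → x ≡ y → a ≡ c → b ≡ d → u′ ≡ v′ →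
                   combination u x a b u′ ≡ combination v y c d v′
combination-cong refl refl refl refl refl = refl

-- The implications turn the two terms on the left into `u - x` and `x - (a ∨ b)`;
-- inclusion-exclusion expands `a ∨ b` as `a + b - (a ∧ b)`. The first three clauses discard the
-- truth values that the implications forbid.
toggle-combination : ∀ u x a b →
  (x ≡ true → u ≡ true) → (a ≡ true → x ≡ true) → (b ≡ true → x ≡ true) →
  ⟦ u ∧ not x ⟧ ℚ.- ⟦ x ∧ not (a ∨ b) ⟧ ≡ combination u x a b (a ∧ b)
toggle-combination false true  _     _     x⇒u _   _   with () ← x⇒u refl
toggle-combination _     false true  _     _   a⇒x _   with () ← a⇒x refl
toggle-combination _     false false true  _   _   b⇒x with () ← b⇒x refl
toggle-combination true  true  true  true  _   _   _   = refl
toggle-combination true  true  true  false _   _   _   = refl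
toggle-combination true  true  false true  _   _   _   = refl
toggle-combination true  true  false false _   _   _   = refl
toggle-combination true  false false false _   _   _   = refl
toggle-combination false false false false _   _   _   = refl

Tᵠ : ∀ {n} → 𝒥 n → Cell → ℚ
Tᵠ I x = ⟦ does (minimalOutside? x I) ⟧ ℚ.- ⟦ does (maximalInside? x I) ⟧

seq-T : ∀ {n} (I : 𝒥 n) x m → seq (T x I) m ≡ Tᵠ I x
seq-T I x m = cong₂ ℚ._-_ (seq-indicator (minimalOutside? x I) m) (seq-indicator (maximalInside? x I) m)

Tᵠ-∉P : ∀ {n} (I : 𝒥 n) x → ¬ x ∈Φ⁺B n → Tᵠ I x ≡ 0ℚ
Tᵠ-∉P I x x∉P rewrite T⁺-∉P I x x∉P | T⁻-∉P I x x∉P = refl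

-- Telescoping along an even diagonal

module _ {n : ℕ} (I : 𝒥 n) {k : ℕ} (2∣k : 2 ∣ k) (k<2n : k < 2 * n) where

  -- The level `2i + k` is even, so a step along the diagonal cannot jump from below `2 * n` to
  -- above it. For odd `k` it could go from `2n - 1` to `2n + 1`.
  level-even : ∀ i → level (diag k i) < 2 * n → level (diag k (suc i)) ≤ 2 * n
  level-even i <2n = go 2∣k
    where
    double : ∀ i q → i + (i + q * 2) ≡ 2 * (i + q)
    double = solve 2 (λ i q → i :+ (i :+ q :* con 2) := con 2 :* (i :+ q)) refl
      where open ℕSolver.+-*-Solver using (solve; _:=_; _:+_; _:*_; con)
    go : 2 ∣ k → level (diag k (suc i)) ≤ 2 * n
    go (divides q refl) = subst (_≤ 2 * n) (sym (double (suc i) q))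
      (ℕ.*-monoʳ-≤ 2 (ℕ.*-cancelˡ-< 2 (i + q) n (subst (_< 2 * n) (double i q) <2n)))

  low∉P : ∀ x → level x < 2 * n → ¬ x ∈Φ⁺B n
  low∉P x <2n (_ , _ , _ , 2n≤) = ℕ.<⇒≱ <2n 2n≤

  -- The lower neighbour `(i - 1 , i + k)` has second coordinate at least `2 * n`, so it is not in P
  -- and not in `I`. The index 0, where `lower⊆I` is true by default, is ruled out by `k < 2 * n`.
  lower⊆I-beyond : ∀ i → 2 * n ≤ i + k → lower⊆I I k i ≡ false
  lower⊆I-beyond zero    2n≤k = ⊥-elim (ℕ.<⇒≱ k<2n 2n≤k)
  lower⊆I-beyond (suc i) 2n≤ = trans (lower⊆I-high I k i (s≤s (ℕ.≤-trans 2n≤ (ℕ.m≤n+m _ i))))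
    (cong (_∧ member I (upⁱ k i)) (∉P⇒≡false I _ λ a∈P → ℕ.<⇒≱ (∈Φ⁺B⇒< n a∈P) 2n≤))

  lower⊆I-below : ∀ i → level (diag k i) < 2 * n → lower⊆I I k i ≡ true
  lower⊆I-below zero    _   = refl
  lower⊆I-below (suc i) <2n = lower⊆I-low I k i (ℕ.<⇒≤ <2n)

  -- Both sides are zero: the two values of `lower⊆I` are true and cancel, and by parity the upper
  -- neighbours also stay below level `2 * n`.
  Tᵠ-low : ∀ i → level (diag k i) < 2 * n → Tᵠ I (diag k i) ≡
    combination (lower⊆I I k i) (member I (diag k i)) (member I (upʲ k i)) (member I (upⁱ k i))
                (lower⊆I I k (suc i))
  Tᵠ-low i <2n = trans (Tᵠ-∉P I (diag k i) (low∉P _ <2n)) (sym (combination-cong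
      (lower⊆I-below i <2n) (∉P⇒≡false I _ (low∉P _ <2n))
      (∉P⇒≡false I _ (low∉P _ (subst (_< 2 * n) (sym (level-upʲ k i)) <2n′)))
      (∉P⇒≡false I _ (low∉P _ (subst (_< 2 * n) (sym (level-upⁱ k i)) <2n′)))
      (lower⊆I-low I k i (level-even i <2n))))
    where
    <2n′ : suc (level (diag k i)) < 2 * n
    <2n′ = subst (_≤ 2 * n) (level-diag-suc k i) (level-even i <2n)

  -- Both sides are zero, since all five truth values on the right are false.
  Tᵠ-beyond : ∀ i → 2 * n ≤ i + k → Tᵠ I (diag k i) ≡
    combination (lower⊆I I k i) (member I (diag k i)) (member I (upʲ k i)) (member I (upⁱ k i))
                (lower⊆I I k (suc i))
  Tᵠ-beyond i 2n≤ = trans (Tᵠ-∉P I (diag k i) (beyond∉P ℕ.≤-refl)) (sym (combination-cong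
      (lower⊆I-beyond i 2n≤) (∉P⇒≡false I _ (beyond∉P ℕ.≤-refl))
      (∉P⇒≡false I _ (beyond∉P (proj₂ (diag≼upʲ k i))))
      (∉P⇒≡false I _ (beyond∉P (proj₂ (diag≼upⁱ k i))))
      (lower⊆I-beyond (suc i) (ℕ.m≤n⇒m≤1+n 2n≤))))
    where
    beyond∉P : ∀ {x} → i + k ≤ proj₂ x → ¬ x ∈Φ⁺B n
    beyond∉P i+k≤ x∈P = ℕ.<⇒≱ (∈Φ⁺B⇒< n x∈P) (ℕ.≤-trans 2n≤ i+k≤)

  Tᵠ-∈P : ∀ i → diag k (suc i) ∈Φ⁺B n → Tᵠ I (diag k (suc i)) ≡
    combination (lower⊆I I k (suc i)) (member I (diag k (suc i)))
                (member I (upʲ k (suc i))) (member I (upⁱ k (suc i))) (lower⊆I I k (suc (suc i)))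
  Tᵠ-∈P i x∈P = begin
      Tᵠ I x
        ≡⟨ cong₂ (λ s t → ⟦ s ⟧ ℚ.- ⟦ t ⟧) (minimalOutside≡ I k i x∈P) (maximalInside≡ I k (suc i)) ⟩
      ⟦ lower⊆I I k (suc i) ∧ not (member I x) ⟧ ℚ.- ⟦ member I x ∧ not (member I a ∨ member I b) ⟧
        ≡⟨ toggle-combination _ (member I x) (member I a) (member I b)
             (diag∈I⇒lower⊆I I k i x∈P)
             (closed I x a x∈P (diag≼upʲ k (suc i))) (closed I x b x∈P (diag≼upⁱ k (suc i))) ⟩
      combination (lower⊆I I k (suc i)) (member I x) (member I a) (member I b) (member I a ∧ member I b)
        -- The cells `a` and `b` are also the lower neighbours of the next cell on the diagonal,
        -- whose level exceeds `2 * n`.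
        ≡⟨ cong (combination (lower⊆I I k (suc i)) (member I x) (member I a) (member I b))
             (sym (lower⊆I-high I k (suc i) high)) ⟩
      combination (lower⊆I I k (suc i)) (member I x) (member I a) (member I b) (lower⊆I I k (suc (suc i))) ∎
    where
    open ≡-Reasoning
    x a b : Cell
    x = diag k (suc i)
    a = upʲ k (suc i)
    b = upⁱ k (suc i)
    high : 2 * n < level (diag k (suc (suc i)))
    high = let _ , _ , _ , 2n≤ = x∈P in
      subst (2 * n <_) (sym (level-diag-suc k (suc i))) (s≤s (ℕ.m≤n⇒m≤1+n 2n≤))

  Tᵠ-diagonal : ∀ i → Tᵠ I (diag k i) ≡
    combination (lower⊆I I k i) (member I (diag k i)) (member I (upʲ k i)) (member I (upⁱ k i))
                (lower⊆I I k (suc i))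
  Tᵠ-diagonal i with level (diag k i) ℕ.<? 2 * n | 2 * n ℕ.≤? i + k
  ... | yes <2n | _       = Tᵠ-low i <2n
  ... | no  _   | yes 2n≤ = Tᵠ-beyond i 2n≤
  -- At `i = 0` the level is `k`, which is below `2 * n`. All other remaining cells lie in P.
  Tᵠ-diagonal zero    | no ≮2n | no _   = ⊥-elim (≮2n k<2n)
  Tᵠ-diagonal (suc i) | no ≮2n | no ≰   =
    Tᵠ-∈P i (mk∈Φ⁺B n (s≤s z≤n) (ℕ.m≤m+n (suc i) k) (ℕ.≰⇒> ≰) (ℕ.≮⇒≥ ≮2n))

  -- The constant 1 is the default value of `lower⊆I` at index 0; the constant 0 is its value at
  -- `2 * n`, beyond P.
  sum-Tᵠ-diagonal : sum< (2 * n) (λ i → Tᵠ I (diag k i)) ≡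
    1ℚ ℚ.- 2ℚ ℚ.* sum< (2 * n) (λ i → ⟦ member I (diag k i) ⟧)
      ℚ.+ sum< (2 * n) (λ i → ⟦ member I (upʲ k i) ⟧)
      ℚ.+ sum< (2 * n) (λ i → ⟦ member I (upⁱ k i) ⟧) ℚ.- 0ℚ
  sum-Tᵠ-diagonal = trans
      (sum<-telescope (2 * n) (λ i → Tᵠ I (diag k i)) (λ i → ⟦ lower⊆I I k i ⟧) x a b Tᵠ-diagonal)
      (cong (λ u → 1ℚ ℚ.- 2ℚ ℚ.* sum< (2 * n) x ℚ.+ sum< (2 * n) a ℚ.+ sum< (2 * n) b ℚ.- ⟦ u ⟧)
        (lower⊆I-beyond (2 * n) (ℕ.m≤m+n (2 * n) k)))
    where
    x a b : ℕ → ℚ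
    x i = ⟦ member I (diag k i) ⟧
    a i = ⟦ member I (upʲ k i) ⟧
    b i = ⟦ member I (upⁱ k i) ⟧

-- Diagonal sums of indicators

module _ {n : ℕ} (I : 𝒥 n) where

  seq-∑𝟙-diagonal : ∀ d m →
    seq (∑𝟙-diagonal d I) m ≡ sum< (2 * n) (λ i → ⟦ member I (diag d i) ⟧)
  seq-∑𝟙-diagonal d m = begin
      seq (∑𝟙-diagonal d I) m
        ≡⟨ seq-∑ diagonal (λ x → 𝟙 x I) m ⟩
      sum diagonal (λ x → seq (𝟙 x I) m)
        ≡⟨ sum-cong diagonal (λ x → trans (seq-indicator (x ∈ᴵ? I) m) (cong ⟦_⟧ (does≡ x))) ⟩
      sum diagonal (λ x → ⟦ member I x ⟧)
        ≡⟨ sum-diagonal n d _ (λ x x∉P → cong ⟦_⟧ (∉P⇒≡false I x x∉P)) ⟩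
      sum< (2 * n) (λ i → ⟦ member I (diag d i) ⟧) ∎
    where
    open ≡-Reasoning
    diagonal : List Cell
    diagonal = filter (λ (i , j) → j ∸ i ℕ.≟ d) (Φ⁺B n)
    does≡ : ∀ x → does (x ∈ᴵ? I) ≡ member I x
    does≡ x = ≡true⇒does≡ (x ∈ᴵ? I) (λ p → p) (λ p → p)

  sum-upʲ : ∀ k m → sum< (2 * n) (λ i → ⟦ member I (upʲ k i) ⟧) ≡ seq (∑𝟙-diagonal (suc k) I) m
  sum-upʲ k m = trans
    (sum<-cong (2 * n) (λ i → cong (λ j → ⟦ member I (i , j) ⟧) (sym (ℕ.+-suc i k))))
    (sym (seq-∑𝟙-diagonal (suc k) m))

  -- These neighbours form the diagonal of difference `k` with the index shifted by one. The shift
  -- is harmless because the end cells `(0 , k)` and `(2n , 2n + k)` are outside P.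
  sum-upⁱ : ∀ k m → sum< (2 * n) (λ i → ⟦ member I (upⁱ (suc k) i) ⟧) ≡ seq (∑𝟙-diagonal k I) m
  sum-upⁱ k m = begin
      sum< (2 * n) (λ i → ⟦ member I (upⁱ (suc k) i) ⟧)
        ≡⟨ sum<-cong (2 * n) (λ i → cong (λ j → ⟦ member I (suc i , j) ⟧) (ℕ.+-suc i k)) ⟩
      sum< (2 * n) (λ i → ⟦ member I (diag k (suc i)) ⟧)
        ≡⟨ sum<-shift (2 * n) (λ i → ⟦ member I (diag k i) ⟧)
             (cong ⟦_⟧ (∉P⇒≡false I _ λ { (() , _) }))
             (cong ⟦_⟧ (∉P⇒≡false I _ λ x∈P → ℕ.<⇒≱ (∈Φ⁺B⇒< n x∈P) (ℕ.m≤m+n (2 * n) k))) ⟩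
      sum< (2 * n) (λ i → ⟦ member I (diag k i) ⟧)
        ≡⟨ sym (seq-∑𝟙-diagonal k m) ⟩
      seq (∑𝟙-diagonal k I) m ∎
    where open ≡-Reasoning

-- The combination of toggles and the resulting relations

coefficient : ℕ → Cell → ℝ
coefficient k (i , j) = -ᴿ indicator (j ∸ i ℕ.≟ k)

seq-∑-coefficient : ∀ {n} (I : 𝒥 n) k m →
  seq (∑ (Φ⁺B n) (λ x → coefficient k x *ᴿ T x I)) m ≡
  ℚ.- sum< (2 * n) (λ i → Tᵠ I (diag k i))
seq-∑-coefficient {n} I k m = begin
    seq (∑ (Φ⁺B n) (λ x → coefficient k x *ᴿ T x I)) m
      ≡⟨ seq-∑ (Φ⁺B n) (λ x → coefficient k x *ᴿ T x I) m ⟩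
    sum (Φ⁺B n) (λ x → seq (coefficient k x) m ℚ.* seq (T x I) m)
      ≡⟨ sum-cong (Φ⁺B n) pointwise ⟩
    sum (Φ⁺B n) (λ x → ℚ.- (if does (diag? x) then Tᵠ I x else 0ℚ))
      ≡⟨ sum-neg (Φ⁺B n) _ ⟩
    ℚ.- sum (Φ⁺B n) (λ x → if does (diag? x) then Tᵠ I x else 0ℚ)
      ≡⟨ cong ℚ.-_ (sym (sum-filter diag? (Φ⁺B n) (Tᵠ I))) ⟩
    ℚ.- sum (filter diag? (Φ⁺B n)) (Tᵠ I)
      ≡⟨ cong ℚ.-_ (sum-diagonal n k (Tᵠ I) (Tᵠ-∉P I)) ⟩
    ℚ.- sum< (2 * n) (λ i → Tᵠ I (diag k i)) ∎
  where
  open ≡-Reasoning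
  diag? : Decidable {A = Cell} (λ (i , j) → j ∸ i ≡ k)
  diag? (i , j) = j ∸ i ℕ.≟ k

  if-* : ∀ b t → ℚ.- ⟦ b ⟧ ℚ.* t ≡ ℚ.- (if b then t else 0ℚ)
  if-* true  t = solve 1 (λ t → :- con 1ℚ :* t := :- t) refl t
    where open +-*-Solver using (solve; _:=_; _:+_; _:*_; _:-_; :-_; con)
  if-* false t = ℚ.*-zeroˡ t

  pointwise : ∀ x → seq (coefficient k x) m ℚ.* seq (T x I) m ≡
                    ℚ.- (if does (diag? x) then Tᵠ I x else 0ℚ)
  pointwise x = trans
    (cong₂ (λ c t → ℚ.- c ℚ.* t) (seq-indicator (diag? x) m) (seq-T I x m))
    (if-* (does (diag? x)) (Tᵠ I x))

-- The sum over `upⁱ` is left unevaluated so that one statement covers all even `k`: it is the sum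
-- over diagonal `k - 1` for positive `k`, and over diagonal 1 for `k = 0`.
diagonal-relation : ∀ {n} (I : 𝒥 n) {k} → 2 ∣ k → k < 2 * n → ∀ m →
  2ℚ ℚ.* seq (∑𝟙-diagonal k I) m ℚ.- sum< (2 * n) (λ i → ⟦ member I (upⁱ k i) ⟧)
    ℚ.- seq (∑𝟙-diagonal (suc k) I) m ℚ.- 1ℚ
  ≡ seq (∑ (Φ⁺B n) (λ x → coefficient k x *ᴿ T x I)) m
diagonal-relation {n} I {k} 2∣k k<2n m = begin
    2ℚ ℚ.* seq (∑𝟙-diagonal k I) m ℚ.- sb ℚ.- seq (∑𝟙-diagonal (suc k) I) m ℚ.- 1ℚ
      ≡⟨ cong₂ (λ x a → 2ℚ ℚ.* x ℚ.- sb ℚ.- a ℚ.- 1ℚ) (seq-∑𝟙-diagonal I k m) (sym (sum-upʲ I k m)) ⟩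
    2ℚ ℚ.* sx ℚ.- sb ℚ.- sa ℚ.- 1ℚ
      ≡⟨ negate sx sa sb ⟩
    ℚ.- (1ℚ ℚ.- 2ℚ ℚ.* sx ℚ.+ sa ℚ.+ sb ℚ.- 0ℚ)
      ≡⟨ cong ℚ.-_ (sym (sum-Tᵠ-diagonal I 2∣k k<2n)) ⟩
    ℚ.- sum< (2 * n) (λ i → Tᵠ I (diag k i))
      ≡⟨ sym (seq-∑-coefficient I k m) ⟩
    seq (∑ (Φ⁺B n) (λ x → coefficient k x *ᴿ T x I)) m ∎
  where
  open ≡-Reasoning
  sx sa sb : ℚ
  sx = sum< (2 * n) (λ i → ⟦ member I (diag k i) ⟧)
  sa = sum< (2 * n) (λ i → ⟦ member I (upʲ k i) ⟧)
  sb = sum< (2 * n) (λ i → ⟦ member I (upⁱ k i) ⟧)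

  negate : ∀ x a b → 2ℚ ℚ.* x ℚ.- b ℚ.- a ℚ.- 1ℚ ≡
                     ℚ.- (1ℚ ℚ.- 2ℚ ℚ.* x ℚ.+ a ℚ.+ b ℚ.- 0ℚ)
  negate = solve 3 (λ x a b → con 2ℚ :* x :- b :- a :- con 1ℚ
      := :- (con 1ℚ :- con 2ℚ :* x :+ a :+ b :- con 0ℚ)) refl
    where open +-*-Solver using (solve; _:=_; _:+_; _:*_; _:-_; :-_; con)

theorem3p37 : (n : ℕ) → 1 ≤ n →
    ((k : ℕ) → 2 ∣ k → 2 ≤ k → k ≤ 2 * n ∸ 2 →
    (λ (I : 𝒥 n) → 2ℝ *ᴿ ∑𝟙-diagonal k I -ᴿ ∑𝟙-diagonal (k ∸ 1) I -ᴿ ∑𝟙-diagonal (k + 1) I)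
    ≡ᵀ (λ _ → 1ℝ))
    × ((λ (I : 𝒥 n) → 2ℝ *ᴿ ∑𝟙-diagonal 0 I -ᴿ 2ℝ *ᴿ ∑𝟙-diagonal 1 I) ≡ᵀ (λ _ → 1ℝ))
theorem3p37 n 1≤n = positive , coefficient 0 , λ I →
    seq≡⇒≃ (2ℝ *ᴿ ∑𝟙-diagonal 0 I -ᴿ 2ℝ *ᴿ ∑𝟙-diagonal 1 I -ᴿ 1ℝ)
           (∑ (Φ⁺B n) (λ x → coefficient 0 x *ᴿ T x I)) (zeroth I)
  where
  positive : (k : ℕ) → 2 ∣ k → 2 ≤ k → k ≤ 2 * n ∸ 2 →
    (λ (I : 𝒥 n) → 2ℝ *ᴿ ∑𝟙-diagonal k I -ᴿ ∑𝟙-diagonal (k ∸ 1) I -ᴿ ∑𝟙-diagonal (k + 1) I)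
    ≡ᵀ (λ _ → 1ℝ)
  positive k@(suc k′) 2∣k _ k≤ = coefficient k , λ I →
      seq≡⇒≃ (2ℝ *ᴿ ∑𝟙-diagonal k I -ᴿ ∑𝟙-diagonal k′ I -ᴿ ∑𝟙-diagonal (k + 1) I -ᴿ 1ℝ)
             (∑ (Φ⁺B n) (λ x → coefficient k x *ᴿ T x I)) λ m → trans
      (cong₂ (λ b a → 2ℚ ℚ.* seq (∑𝟙-diagonal k I) m ℚ.- b ℚ.- a ℚ.- 1ℚ)
        (sym (sum-upⁱ I k′ m)) (cong (λ d → seq (∑𝟙-diagonal d I) m) (ℕ.+-comm k 1)))
      (diagonal-relation I 2∣k k<2n m)
    where
    k<2n : k < 2 * n
    -- From `1 ≤ n` comes `2 ≤ 2 * n`, so subtracting 2 is not truncated and strictly decreases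
    -- `2 * n`.
    k<2n = ℕ.≤-<-trans k≤ (ℕ.∸-monoʳ-< {2 * n} {2} {0} (s≤s z≤n) (ℕ.*-monoʳ-≤ 2 1≤n))

  split-double : ∀ x a → 2ℚ ℚ.* x ℚ.- 2ℚ ℚ.* a ℚ.- 1ℚ ≡ 2ℚ ℚ.* x ℚ.- a ℚ.- a ℚ.- 1ℚ
  split-double = solve 2 (λ x a →
      con 2ℚ :* x :- con 2ℚ :* a :- con 1ℚ := con 2ℚ :* x :- a :- a :- con 1ℚ) refl
    where open +-*-Solver using (solve; _:=_; _:*_; _:-_; con)

  zeroth : ∀ (I : 𝒥 n) m →
    2ℚ ℚ.* seq (∑𝟙-diagonal 0 I) m ℚ.- 2ℚ ℚ.* seq (∑𝟙-diagonal 1 I) m ℚ.- 1ℚ ≡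
    seq (∑ (Φ⁺B n) (λ x → coefficient 0 x *ᴿ T x I)) m
  zeroth I m = trans
    (split-double (seq (∑𝟙-diagonal 0 I) m) (seq (∑𝟙-diagonal 1 I) m))
    -- At `k = 0` reflection makes `upⁱ` and `upʲ` the same cell, so diagonal 1 is counted twice.
    (trans (cong (λ b → 2ℚ ℚ.* seq (∑𝟙-diagonal 0 I) m ℚ.- b ℚ.- seq (∑𝟙-diagonal 1 I) m ℚ.- 1ℚ)
             (sym (sum-upʲ I 0 m)))
      (diagonal-relation I {0} (divides 0 refl) (ℕ.<-≤-trans (s≤s z≤n) (ℕ.*-monoʳ-≤ 2 1≤n)) m))
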